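{- Let $p\ge 3$ be a prime and let $\alpha,\beta\ge 1$ be integers. (i) If $\bar a_{2\alpha}(2p)\equiv 0\pmod 2$, then for all integers $n,k\ge 0$ with $p\nmid(2n+1)$, $$\bar a_{2\alpha}\left(4p^{2k+1}n+2p^{2k+1}\right)\equiv 0\pmod 4.$$ (ii) If $\bar a_{2\beta+1}(2p)\equiv 0\pmod 2$, then for all integers $n,k\ge 0$ with $p\nmid(2n+1)$, $$\bar a_{2\beta+1}\left(4p^{2k+1}n+2p^{2k+1}\right)\equiv 0\pmod 8.$$
   Context: For integers $\ell\ge1$ write $f_\ell=\prod_{j\ge 1}(1-q^{\ell j})$. For a positive integer $s$, $\bar a_s(n)$ denotes the number of partitions of $n$ in which each odd part occurs in one of $s$ colors and the first occurrence of each part (parts of the same size but different colors being distinct) may be overlined. Equivalently, $$\sum_{n\ge0}\bar a_s(n)q^n=\frac{f_2^{3s-2}}{f_1^{2s}f_4^{s-1}}.$$ -}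

module Defs where

open import Data.Bool using (Bool; true; false; if_then_else_)
open import Data.Bool.Properties using () renaming (_≟_ to _≟ᵇ_)
open import Data.List using (List; []; _∷_; map; concatMap; cartesianProductWith; filter; length; upTo)
open import Data.List.Relation.Unary.Linked using (Linked; linked?)
open import Data.Nat using (ℕ; zero; suc; _<_; _≟_; _<?_)
open import Data.Nat.Divisibility using (_∣?_)
open import Data.Nat.ListAction using (sum)
open import Data.Product using (_×_)
open import Data.Sum using (_⊎_)
open import Relation.Binary using (Decidable)
open import Relation.Binary.PropositionalEquality using (_≡_)
open import Relation.Nullary using (Dec)
open import Relation.Nullary.Decidable using (⌊_⌋; _×-dec_; _⊎-dec_)

record Part : Set where
  constructor part
  field
    size      : ℕ
    colour    : ℕ
    overlined : Bool

open Part public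

-- Odd parts come in s colours, even parts in a single one.
colours : ℕ → ℕ → ℕ
colours s j = if ⌊ 2 ∣? j ⌋ then 1 else s

parts : ℕ → ℕ → List Part
parts s n = concatMap (λ j → cartesianProductWith (part j) (upTo (colours s j)) (false ∷ true ∷ []))
                      (map suc (upTo n))

-- x ▷ y : y may directly follow x.  A partition is listed with (size , colour)
-- lexicographically non-increasing, so equal parts are adjacent; an occurrence
-- preceded by an equal part is not the first one and must not be overlined.
_▷_ : Part → Part → Set
x ▷ y = size y < size x
      ⊎ (size y ≡ size x × (colour y < colour x
                           ⊎ (colour y ≡ colour x × overlined y ≡ false)))

_▷?_ : Decidable _▷_
x ▷? y = (size y <? size x)
   ⊎-dec ((size y ≟ size x) ×-dec ((colour y <? colour x)
                            ⊎-dec ((colour y ≟ colour x) ×-dec (overlined y ≟ᵇ false))))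

IsOverpartition : ℕ → List Part → Set
IsOverpartition n ps = Linked _▷_ ps × sum (map size ps) ≡ n

isOverpartition? : ∀ n ps → Dec (IsOverpartition n ps)
isOverpartition? n ps = linked? _▷?_ ps ×-dec (sum (map size ps) ≟ n)

words : {A : Set} → ℕ → List A → List (List A)
words zero    xs = [] ∷ []
words (suc l) xs = cartesianProductWith _∷_ xs (words l xs)

-- Parts are positive, so a partition of n has at most n parts, each of size at
-- most n: no partition of n is missed here.
candidates : ℕ → ℕ → List (List Part)
candidates s n = concatMap (λ l → words l (parts s n)) (upTo (suc n))

ā : ℕ → ℕ → ℕ
ā s n = length (filter (isOverpartition? n) (candidates s n))

{-# OPTIONS --safe #-}
-- Put N = 2 p^(2k+1) (2n+1) = 2 M with M odd and not a square.  Modulo 8 the number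
-- ā s N is 2 e₁ + 4 e₂, where e_r counts the partitions of N with exactly r different
-- coloured parts and no overlines, since the first occurrence of each part may or may
-- not be overlined.
-- Twice an odd number has as many even as odd divisors, so e₁ = (s + 1) d(M), and d(M)
-- is even because M is not a square.  For odd s the parity of e₂ is found by involutions on the
-- solutions of x a + y b = N: for parts of different sizes conjugation has no fixed
-- point as 4 ∤ N, and parts of equal size again reduce to d(M).
-- To reach e₁ and e₂ from the enumeration by words, a partition is read off from its
-- largest part on: the parts that may follow a given one are the part itself, plain,
-- and every smaller part in two overlinings.
module Submission where

open import Defs
open import Algebra.Properties.CommutativeSemigroup using (interchange)
open import Data.Bool using (true; false; if_then_else_)
open import Data.List using (List; []; _∷_; _++_; map; concatMap; cartesianProduct; cartesianProductWith; filter; length; upTo)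
open import Data.List.Membership.Propositional using (_∈_)
open import Data.List.Membership.Propositional.Properties using (∈-map⁺; ∈-map⁻; ∈-upTo⁺; ∈-upTo⁻)
open import Data.List.Properties using (map-++; map-∘; map-upTo; length-upTo)
open import Data.List.Relation.Unary.All using (lookup)
open import Data.List.Relation.Unary.AllPairs using (_∷_)
open import Data.List.Relation.Unary.Any using (here; there)
open import Data.List.Relation.Unary.Linked using (linked?)
open import Data.List.Relation.Unary.Unique.Propositional using (Unique)
open import Data.List.Relation.Unary.Unique.Propositional.Properties using (upTo⁺) renaming (map⁺ to Unique-map⁺)
open import Data.Nat
open import Data.Nat.Divisibility
open import Data.Nat.ListAction using (sum)
open import Data.Nat.ListAction.Properties using (sum-++)
open import Data.Nat.Primality using (Prime; euclidsLemma; prime[2]; ¬prime[1]; prime⇒irreducible; prime⇒nonZero)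
open import Data.Nat.Properties
open import Data.Nat.Tactic.RingSolver using (solve-∀)
open import Data.Product using (_×_; _,_; proj₁; proj₂; ∃; ∃₂)
open import Data.Sum using (_⊎_; inj₁; inj₂)
open import Function using (_∘_)
open import Relation.Binary.PropositionalEquality
open import Relation.Binary.Definitions using (tri<; tri≈; tri>)
open import Relation.Nullary using (Dec; yes; no; does; ¬_; contradiction)
open import Relation.Nullary.Decidable using (_×-dec_; dec-true; dec-false; isYes≗does)

private variable
  A B C : Set
  P Q : Set

-- Indicators of decidable propositions

𝟙 : Dec P → ℕ
𝟙 d = if does d then 1 else 0

𝟙-yes : (d : Dec P) → P → 𝟙 d ≡ 1
𝟙-yes d p = cong (if_then 1 else 0) (dec-true d p)

𝟙-no : (d : Dec P) → ¬ P → 𝟙 d ≡ 0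
𝟙-no d ¬p = cong (if_then 1 else 0) (dec-false d ¬p)

𝟙-cong : (d : Dec P) (e : Dec Q) → (P → Q) → (Q → P) → 𝟙 d ≡ 𝟙 e
𝟙-cong (yes p) e f g = sym (𝟙-yes e (f p))
𝟙-cong (no ¬p) e f g = sym (𝟙-no e (¬p ∘ g))

𝟙-× : (d : Dec P) (e : Dec Q) → 𝟙 (d ×-dec e) ≡ 𝟙 d * 𝟙 e
𝟙-× (yes _) (yes _) = refl
𝟙-× (yes _) (no _)  = refl
𝟙-× (no _)  _       = refl

-- Finite sums

∑ : List A → (A → ℕ) → ℕ
∑ xs f = sum (map f xs)

∑-cong : (xs : List A) {f g : A → ℕ} → (∀ {x} → x ∈ xs → f x ≡ g x) → ∑ xs f ≡ ∑ xs g
∑-cong []       eq = refl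
∑-cong (x ∷ xs) eq = cong₂ _+_ (eq (here refl)) (∑-cong xs (eq ∘ there))

∑-zero : (xs : List A) {f : A → ℕ} → (∀ {x} → x ∈ xs → f x ≡ 0) → ∑ xs f ≡ 0
∑-zero []       eq = refl
∑-zero (x ∷ xs) eq = cong₂ _+_ (eq (here refl)) (∑-zero xs (eq ∘ there))

∑-distrib-+ : (xs : List A) (f g : A → ℕ) → ∑ xs (λ x → f x + g x) ≡ ∑ xs f + ∑ xs g
∑-distrib-+ []       f g = refl
∑-distrib-+ (x ∷ xs) f g = trans (cong (f x + g x +_) (∑-distrib-+ xs f g))
                                 (interchange +-commutativeSemigroup (f x) (g x) _ _)

*-distribˡ-∑ : (k : ℕ) (xs : List A) (f : A → ℕ) → k * ∑ xs f ≡ ∑ xs (λ x → k * f x)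
*-distribˡ-∑ k []       f = *-zeroʳ k
*-distribˡ-∑ k (x ∷ xs) f = trans (*-distribˡ-+ k (f x) _) (cong (k * f x +_) (*-distribˡ-∑ k xs f))

∑-const : (xs : List A) (k : ℕ) → ∑ xs (λ _ → k) ≡ length xs * k
∑-const []       k = refl
∑-const (x ∷ xs) k = cong (k +_) (∑-const xs k)

∑-++ : (xs ys : List A) (f : A → ℕ) → ∑ (xs ++ ys) f ≡ ∑ xs f + ∑ ys f
∑-++ xs ys f = trans (cong sum (map-++ f xs ys)) (sum-++ (map f xs) (map f ys))

∑-map : (g : A → B) (xs : List A) (f : B → ℕ) → ∑ (map g xs) f ≡ ∑ xs (f ∘ g)
∑-map g xs f = cong sum (sym (map-∘ xs))

∑-concatMap : (g : A → List B) (xs : List A) (f : B → ℕ) → ∑ (concatMap g xs) f ≡ ∑ xs (λ x → ∑ (g x) f)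
∑-concatMap g []       f = refl
∑-concatMap g (x ∷ xs) f = trans (∑-++ (g x) _ f) (cong (∑ (g x) f +_) (∑-concatMap g xs f))

∑-cartesianProductWith : (g : A → B → C) (xs : List A) (ys : List B) (f : C → ℕ) →
  ∑ (cartesianProductWith g xs ys) f ≡ ∑ xs (λ x → ∑ ys (λ y → f (g x y)))
∑-cartesianProductWith g []       ys f = refl
∑-cartesianProductWith g (x ∷ xs) ys f =
  trans (∑-++ (map (g x) ys) _ f) (cong₂ _+_ (∑-map (g x) ys f) (∑-cartesianProductWith g xs ys f))

∑-swap : (xs : List A) (ys : List B) (f : A → B → ℕ) →
  ∑ xs (λ x → ∑ ys (f x)) ≡ ∑ ys (λ y → ∑ xs (λ x → f x y))
∑-swap []       ys f = sym (∑-zero ys (λ _ → refl))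
∑-swap (x ∷ xs) ys f = trans (cong (∑ ys (f x) +_) (∑-swap xs ys f))
                             (sym (∑-distrib-+ ys (f x) _))

length-filter≡∑ : {R : A → Set} (R? : ∀ x → Dec (R x)) (xs : List A) → length (filter R? xs) ≡ ∑ xs (𝟙 ∘ R?)
length-filter≡∑ R? []       = refl
length-filter≡∑ R? (x ∷ xs) with does (R? x)
... | true  = cong suc (length-filter≡∑ R? xs)
... | false = length-filter≡∑ R? xs

∑-single : {xs : List A} {x : A} {f : A → ℕ} → Unique xs → x ∈ xs →
  (∀ {y} → y ∈ xs → y ≢ x → f y ≡ 0) → ∑ xs f ≡ f x
∑-single {xs = x ∷ xs} {f = f} (x∉ ∷ _) (here refl) off =
  trans (cong (f x +_) (∑-zero xs (λ y∈ → off (there y∈) (lookup x∉ y∈ ∘ sym)))) (+-identityʳ _)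
∑-single {xs = z ∷ xs} (z∉ ∷ u) (there x∈) off =
  cong₂ _+_ (off (here refl) (lookup z∉ x∈)) (∑-single u x∈ (off ∘ there))

-- Double counting: `f a` is summed over the pairs with `a ≡ φ c`, first along `Y`, then along `X`.
-- The alternatives with value 0 allow ranges that do not match exactly, as when both are cut off at
-- the same bound.
∑-reindex : {X Y : List ℕ} {f : ℕ → ℕ} (φ : ℕ → ℕ) → Unique X → Unique Y → (∀ {c d} → φ c ≡ φ d → c ≡ d) →
  (∀ {c} → c ∈ Y → φ c ∈ X ⊎ f (φ c) ≡ 0) →
  (∀ {a} → a ∈ X → (∃ λ c → c ∈ Y × a ≡ φ c) ⊎ f a ≡ 0) →
  ∑ X f ≡ ∑ Y (f ∘ φ)
∑-reindex {X} {Y} {f} φ uX uY φ-inj into onto = begin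
  ∑ X f                                          ≡⟨ ∑-cong X fibre ⟨
  ∑ X (λ a → ∑ Y (λ c → 𝟙 (a ≟ φ c) * f a))     ≡⟨ ∑-swap X Y _ ⟩
  ∑ Y (λ c → ∑ X (λ a → 𝟙 (a ≟ φ c) * f a))     ≡⟨ ∑-cong Y image ⟩
  ∑ Y (f ∘ φ)                                    ∎
  where
  open ≡-Reasoning
  𝟙* : ∀ {a b} → a ≡ b → 𝟙 (a ≟ b) * f a ≡ f a
  𝟙* {a} {b} eq = trans (cong (_* f a) (𝟙-yes (a ≟ b) eq)) (*-identityˡ _)

  fibre : ∀ {a} → a ∈ X → ∑ Y (λ c → 𝟙 (a ≟ φ c) * f a) ≡ f a
  fibre {a} a∈ with onto a∈
  ... | inj₂ fa≡0 = trans (∑-zero Y λ {c} _ → trans (cong (𝟙 (a ≟ φ c) *_) fa≡0) (*-zeroʳ (𝟙 (a ≟ φ c)))) (sym fa≡0)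
  ... | inj₁ (c , c∈ , refl) = trans
    (∑-single uY c∈ λ {d} _ d≢c → cong (_* f (φ c)) (𝟙-no (φ c ≟ φ d) (d≢c ∘ sym ∘ φ-inj)))
    (𝟙* refl)

  image : ∀ {c} → c ∈ Y → ∑ X (λ a → 𝟙 (a ≟ φ c) * f a) ≡ f (φ c)
  image {c} c∈ with into c∈
  ... | inj₁ φc∈ = trans
    (∑-single uX φc∈ λ {a} _ a≢ → cong (_* f a) (𝟙-no (a ≟ φ c) a≢))
    (𝟙* refl)
  ... | inj₂ fφc≡0 = trans (∑-zero X vanish) (sym fφc≡0)
    where
    vanish : ∀ {a} → a ∈ X → 𝟙 (a ≟ φ c) * f a ≡ 0
    vanish {a} _ with a ≟ φ c
    ... | yes eq = trans (cong (𝟙 (a ≟ φ c) *_) (trans (cong f eq) fφc≡0)) (*-zeroʳ (𝟙 (a ≟ φ c)))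
    ... | no a≢  = cong (_* f a) (𝟙-no (a ≟ φ c) a≢)

-- Congruences

infix 4 _≈_[mod_]

-- Multiples of `k` are added on both sides, which avoids both subtraction on ℕ and a comparison of
-- `a` with `b`.
_≈_[mod_] : ℕ → ℕ → ℕ → Set
a ≈ b [mod k ] = ∃₂ λ x y → a + x * k ≡ b + y * k

module _ {k : ℕ} where

  ≈-reflexive : ∀ {a b} → a ≡ b → a ≈ b [mod k ]
  ≈-reflexive refl = 0 , 0 , refl

  ≈-trans : ∀ {a b c} → a ≈ b [mod k ] → b ≈ c [mod k ] → a ≈ c [mod k ]
  ≈-trans {a} {b} {c} (x , y , eq) (u , v , eq′) = x + u , v + y , (begin
    a + (x + u) * k     ≡⟨ regroup a x u k ⟩
    a + x * k + u * k   ≡⟨ cong (_+ u * k) eq ⟩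
    b + y * k + u * k   ≡⟨ swap b y u k ⟩
    b + u * k + y * k   ≡⟨ cong (_+ y * k) eq′ ⟩
    c + v * k + y * k   ≡⟨ regroup c v y k ⟨
    c + (v + y) * k     ∎)
    where
    open ≡-Reasoning
    regroup : ∀ a x u k → a + (x + u) * k ≡ a + x * k + u * k
    regroup = solve-∀
    swap : ∀ b y u k → b + y * k + u * k ≡ b + u * k + y * k
    swap = solve-∀

  ≈-+ : ∀ {a b c d} → a ≈ b [mod k ] → c ≈ d [mod k ] → a + c ≈ b + d [mod k ]
  ≈-+ {a} {b} {c} {d} (x , y , eq) (u , v , eq′) = x + u , y + v ,
    trans (regroup a c x u k) (trans (cong₂ _+_ eq eq′) (sym (regroup b d y v k)))
    where
    regroup : ∀ a c x u k → a + c + (x + u) * k ≡ a + x * k + (c + u * k)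
    regroup = solve-∀

  ≈-*ˡ : ∀ c {a b} → a ≈ b [mod k ] → c * a ≈ c * b [mod k ]
  ≈-*ˡ c {a} {b} (x , y , eq) = c * x , c * y ,
    trans (regroup c a x k) (trans (cong (c *_) eq) (sym (regroup c b y k)))
    where
    regroup : ∀ c a x k → c * a + c * x * k ≡ c * (a + x * k)
    regroup = solve-∀

  -- The modulus grows with the factor. The factors 2 that come from overlinings thus lift
  -- congruences from modulus 2 to 4 and from 4 to 8.
  ≈-scale : ∀ c {a b} → a ≈ b [mod k ] → c * a ≈ c * b [mod c * k ]
  ≈-scale c {a} {b} (x , y , eq) = x , y ,
    trans (regroup c a x k) (trans (cong (c *_) eq) (sym (regroup c b y k)))
    where
    regroup : ∀ c a x k → c * a + x * (c * k) ≡ c * (a + x * k)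
    regroup = solve-∀

  ≈-coarsen : ∀ c {a b} → a ≈ b [mod c * k ] → a ≈ b [mod k ]
  ≈-coarsen c {a} {b} (x , y , eq) = x * c , y * c ,
    trans (cong (a +_) (*-assoc x c k)) (trans eq (cong (b +_) (sym (*-assoc y c k))))

  ≈-∑ : (xs : List A) {f g : A → ℕ} → (∀ {x} → x ∈ xs → f x ≈ g x [mod k ]) → ∑ xs f ≈ ∑ xs g [mod k ]
  ≈-∑ []       eq = ≈-reflexive refl
  ≈-∑ (x ∷ xs) eq = ≈-+ (eq (here refl)) (≈-∑ xs (eq ∘ there))

  ≈0⇒∣ : ∀ {a} → a ≈ 0 [mod k ] → k ∣ a
  ≈0⇒∣ {a} (x , y , eq) = ∣m+n∣m⇒∣n (divides y (trans (+-comm (x * k) a) eq)) (divides x refl)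

  ∣⇒≈0 : ∀ {a} → k ∣ a → a ≈ 0 [mod k ]
  ∣⇒≈0 {a} (divides q eq) = 0 , q , trans (+-identityʳ a) eq

-- Off-diagonal terms of a symmetric sum cancel in pairs.
∑-symmetric : (xs : List A) (g : A → A → ℕ) → (∀ x y → g x y ≡ g y x) →
  ∑ xs (λ x → ∑ xs (g x)) ≈ ∑ xs (λ x → g x x) [mod 2 ]
∑-symmetric []       g g-sym = ≈-reflexive refl
∑-symmetric (x ∷ xs) g g-sym =
  ≈-trans (≈-reflexive expand) (≈-+ (≈-reflexive {a = g x x} refl)
    (≈-+ (∣⇒≈0 (m∣m*n r)) (∑-symmetric xs g g-sym)))
  where
  open ≡-Reasoning
  r = ∑ xs (g x)
  t = ∑ xs (λ y → ∑ xs (g y))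
  regroup : ∀ d r t → d + r + (r + t) ≡ d + (2 * r + t)
  regroup = solve-∀
  expand : ∑ (x ∷ xs) (λ y → ∑ (x ∷ xs) (g y)) ≡ g x x + (2 * r + t)
  expand = begin
    g x x + r + ∑ xs (λ y → g y x + ∑ xs (g y))   ≡⟨ cong (g x x + r +_) (∑-distrib-+ xs (λ y → g y x) _) ⟩
    g x x + r + (∑ xs (λ y → g y x) + t)          ≡⟨ cong (λ e → g x x + r + (e + t)) (∑-cong xs λ {y} _ → g-sym y x) ⟩
    g x x + r + (r + t)                           ≡⟨ regroup (g x x) r t ⟩
    g x x + (2 * r + t)                           ∎

-- Overpartitions counted part by part

sizes : ℕ → List ℕ
sizes N = map suc (upTo N)

-- A type is a size with a colour, overlining forgotten; `∑-parts` carries out the sum over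
-- overlinings.
∑types : ℕ → ℕ → (ℕ → ℕ → ℕ) → ℕ
∑types s N f = ∑ (sizes N) λ a → ∑ (upTo (colours s a)) λ i → f a i

∑types-cong : ∀ s N {f g} → (∀ {a i} → a ∈ sizes N → i ∈ upTo (colours s a) → f a i ≡ g a i) →
  ∑types s N f ≡ ∑types s N g
∑types-cong s N eq = ∑-cong (sizes N) λ a∈ → ∑-cong _ λ i∈ → eq a∈ i∈

≈-∑types : ∀ s N {k f g} → (∀ {a i} → a ∈ sizes N → i ∈ upTo (colours s a) → f a i ≈ g a i [mod k ]) →
  ∑types s N f ≈ ∑types s N g [mod k ]
≈-∑types s N eq = ≈-∑ (sizes N) λ a∈ → ≈-∑ _ λ i∈ → eq a∈ i∈

∑types-distrib-+ : ∀ s N f g → ∑types s N (λ a i → f a i + g a i) ≡ ∑types s N f + ∑types s N g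
∑types-distrib-+ s N f g =
  trans (∑-cong (sizes N) λ {a} _ → ∑-distrib-+ (upTo (colours s a)) (f a) (g a)) (∑-distrib-+ (sizes N) _ _)

*-distribˡ-∑types : ∀ k s N f → k * ∑types s N f ≡ ∑types s N (λ a i → k * f a i)
*-distribˡ-∑types k s N f =
  trans (*-distribˡ-∑ k (sizes N) _) (∑-cong (sizes N) λ {a} _ → *-distribˡ-∑ k (upTo (colours s a)) (f a))

∑-∑types-swap : ∀ s N (xs : List A) (f : A → ℕ → ℕ → ℕ) →
  ∑ xs (λ x → ∑types s N (f x)) ≡ ∑types s N (λ a i → ∑ xs (λ x → f x a i))
∑-∑types-swap s N xs f =
  trans (∑-swap xs (sizes N) _) (∑-cong (sizes N) λ {a} _ → ∑-swap xs (upTo (colours s a)) _)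

∑-parts : ∀ s N f → ∑ (parts s N) f ≡ ∑types s N (λ a i → f (part a i false) + f (part a i true))
∑-parts s N f = trans (∑-concatMap _ (sizes N) f) (∑-cong (sizes N) λ {a} _ →
  trans (∑-cartesianProductWith (part a) (upTo (colours s a)) _ f)
        (∑-cong (upTo (colours s a)) λ {i} _ → cong (f (part a i false) +_) (+-identityʳ _)))

sizes-unique : ∀ N → Unique (sizes N)
sizes-unique N = Unique-map⁺ suc-injective (upTo⁺ N)

∑-upTo-suc : ∀ n (f : ℕ → ℕ) → ∑ (upTo (suc n)) f ≡ f 0 + ∑ (upTo n) (f ∘ suc)
∑-upTo-suc n f = cong (f 0 +_) (trans (cong (λ xs → ∑ xs f) (sym (map-upTo suc n))) (∑-map suc (upTo n) f))

∈-sizes⁺ : ∀ {a N} → 1 ≤ a → a ≤ N → a ∈ sizes N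
∈-sizes⁺ {suc a} _ a<N = ∈-map⁺ suc (∈-upTo⁺ a<N)

∈-sizes⁻ : ∀ {a N} → a ∈ sizes N → 1 ≤ a × a ≤ N
∈-sizes⁻ a∈ with ∈-map⁻ suc a∈
... | _ , i∈ , refl = s≤s z≤n , ∈-upTo⁻ i∈

-- The lexicographic order on types as a value 0 or 1: the two summands exclude each other.
below : ℕ → ℕ → ℕ → ℕ → ℕ
below b k a i = 𝟙 (b <? a) + 𝟙 (b ≟ a) * 𝟙 (k <? i)

same : ℕ → ℕ → ℕ → ℕ → ℕ
same b k a i = 𝟙 (b ≟ a) * 𝟙 (k ≟ i)

-- Both overlinings of a smaller part may follow, but only the plain copy of an equal one.
followers : ∀ a i o b k → 𝟙 (part a i o ▷? part b k false) + 𝟙 (part a i o ▷? part b k true)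
                          ≡ 2 * below b k a i + same b k a i
followers a i o b k with <-cmp b a | <-cmp k i
... | tri< b<a b≢a _ | _
  rewrite 𝟙-yes (part a i o ▷? part b k false) (inj₁ b<a) | 𝟙-yes (part a i o ▷? part b k true) (inj₁ b<a)
        | 𝟙-yes (b <? a) b<a | 𝟙-no (b ≟ a) b≢a = refl
... | tri> b≮a b≢a _ | _
  rewrite 𝟙-no (part a i o ▷? part b k false) (λ { (inj₁ b<a) → b≮a b<a ; (inj₂ (b≡a , _)) → b≢a b≡a })
        | 𝟙-no (part a i o ▷? part b k true) (λ { (inj₁ b<a) → b≮a b<a ; (inj₂ (b≡a , _)) → b≢a b≡a })
        | 𝟙-no (b <? a) b≮a | 𝟙-no (b ≟ a) b≢a = refl
... | tri≈ b≮a b≡a _ | tri< k<i k≢i _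
  rewrite 𝟙-yes (part a i o ▷? part b k false) (inj₂ (b≡a , inj₁ k<i))
        | 𝟙-yes (part a i o ▷? part b k true) (inj₂ (b≡a , inj₁ k<i))
        | 𝟙-no (b <? a) b≮a | 𝟙-yes (b ≟ a) b≡a | 𝟙-yes (k <? i) k<i | 𝟙-no (k ≟ i) k≢i = refl
... | tri≈ b≮a b≡a _ | tri≈ k≮i k≡i _
  rewrite 𝟙-yes (part a i o ▷? part b k false) (inj₂ (b≡a , inj₂ (k≡i , refl)))
        | 𝟙-no (part a i o ▷? part b k true)
            (λ { (inj₁ b<a) → b≮a b<a ; (inj₂ (_ , inj₁ k<i)) → k≮i k<i ; (inj₂ (_ , inj₂ (_ , ()))) })
        | 𝟙-no (b <? a) b≮a | 𝟙-yes (b ≟ a) b≡a | 𝟙-no (k <? i) k≮i | 𝟙-yes (k ≟ i) k≡i = refl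
... | tri≈ b≮a b≡a _ | tri> k≮i k≢i _
  rewrite 𝟙-no (part a i o ▷? part b k false)
            (λ { (inj₁ b<a) → b≮a b<a ; (inj₂ (_ , inj₁ k<i)) → k≮i k<i ; (inj₂ (_ , inj₂ (k≡i , _))) → k≢i k≡i })
        | 𝟙-no (part a i o ▷? part b k true)
            (λ { (inj₁ b<a) → b≮a b<a ; (inj₂ (_ , inj₁ k<i)) → k≮i k<i ; (inj₂ (_ , inj₂ (k≡i , _))) → k≢i k≡i })
        | 𝟙-no (b <? a) b≮a | 𝟙-yes (b ≟ a) b≡a | 𝟙-no (k <? i) k≮i | 𝟙-no (k ≟ i) k≢i = refl

∑types-same : ∀ s N {a i} (f : ℕ → ℕ → ℕ) → a ∈ sizes N → i ∈ upTo (colours s a) →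
  ∑types s N (λ b k → same b k a i * f b k) ≡ f a i
∑types-same s N {a} {i} f a∈ i∈ = begin
  ∑types s N (λ b k → same b k a i * f b k)
    ≡⟨ ∑-single (sizes-unique N) a∈ (λ {b} _ b≢a → ∑-zero (upTo (colours s b)) λ {k} _ →
         cong (λ e → e * 𝟙 (k ≟ i) * f b k) (𝟙-no (b ≟ a) b≢a)) ⟩
  ∑ (upTo (colours s a)) (λ k → same a k a i * f a k)
    ≡⟨ ∑-single (upTo⁺ _) i∈ (λ {k} _ k≢i → trans (cong (λ e → 𝟙 (a ≟ a) * e * f a k) (𝟙-no (k ≟ i) k≢i))
                                                   (cong (_* f a k) (*-zeroʳ (𝟙 (a ≟ a))))) ⟩
  same a i a i * f a i
    ≡⟨ cong (_* f a i) (cong₂ _*_ (𝟙-yes (a ≟ a) refl) (𝟙-yes (i ≟ i) refl)) ⟩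
  1 * f a i
    ≡⟨ *-identityˡ _ ⟩
  f a i ∎
  where open ≡-Reasoning

-- Continuations of a chain of parts, modulo 2 and 4

module Chains (s N : ℕ) (h : ℕ → ℕ) where

  -- Weighted count of the ways to continue after `z` by `l` parts. The accumulator `m` stands for
  -- the total size so far, `z` included; `h` weighs the final total and later becomes the indicator
  -- of `N`.
  chains : Part → ℕ → ℕ → ℕ
  chains z l m = ∑ (words l (parts s N)) λ w → 𝟙 (linked? _▷?_ (z ∷ w)) * h (m + sum (map size w))

  𝟙-linked : ∀ z y w → 𝟙 (linked? _▷?_ (z ∷ y ∷ w)) ≡ 𝟙 (z ▷? y) * 𝟙 (linked? _▷?_ (y ∷ w))
  𝟙-linked z y w = 𝟙-× (z ▷? y) (linked? _▷?_ (y ∷ w))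

  chains-∷ : ∀ z l m → chains z (suc l) m ≡ ∑ (parts s N) (λ y → 𝟙 (z ▷? y) * chains y l (m + size y))
  chains-∷ z l m = trans (∑-cartesianProductWith _∷_ (parts s N) (words l (parts s N)) _)
    (∑-cong (parts s N) λ {y} _ → trans
      (∑-cong (words l (parts s N)) λ {w} _ → trans
        (cong₂ _*_ (𝟙-linked z y w) (cong h (sym (+-assoc m (size y) _))))
        (*-assoc (𝟙 (z ▷? y)) _ _))
      (sym (*-distribˡ-∑ (𝟙 (z ▷? y)) (words l (parts s N)) _)))

  plain : ℕ → ℕ → ℕ → ℕ → ℕ
  plain a i = chains (part a i false)

  -- The relation `▷` reads the overlining of its right argument only, so both sides unfold to the
  -- same sum.
  chains-overlined : ∀ a i l m → chains (part a i true) l m ≡ plain a i l m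
  chains-overlined a i zero    m = refl
  chains-overlined a i (suc l) m = trans (chains-∷ (part a i true) l m) (sym (chains-∷ (part a i false) l m))

  ∑below : ℕ → ℕ → (ℕ → ℕ → ℕ) → ℕ
  ∑below a i f = ∑types s N (λ b k → below b k a i * f b k)

  ≈-∑below : ∀ {n} a i {f g} → (∀ {b k} → b ∈ sizes N → k ∈ upTo (colours s b) → f b k ≈ g b k [mod n ]) →
    ∑below a i f ≈ ∑below a i g [mod n ]
  ≈-∑below a i eq = ≈-∑types s N λ {b} {k} b∈ k∈ → ≈-*ˡ (below b k a i) (eq b∈ k∈)

  ∑below-cong : ∀ a i {f g} → (∀ {b k} → b ∈ sizes N → k ∈ upTo (colours s b) → f b k ≡ g b k) →
    ∑below a i f ≡ ∑below a i g
  ∑below-cong a i eq = ∑types-cong s N λ {b} {k} b∈ k∈ → cong (below b k a i *_) (eq b∈ k∈)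

  -- In this recursion every change of type brings a factor 2, so modulo 2 ^ r only chains with
  -- fewer than r changes matter.
  plain-suc : ∀ {a i} l m → a ∈ sizes N → i ∈ upTo (colours s a) →
    plain a i (suc l) m ≡ plain a i l (m + a) + 2 * ∑below a i (λ b k → plain b k l (m + b))
  plain-suc {a} {i} l m a∈ i∈ = begin
    plain a i (suc l) m
      ≡⟨ chains-∷ z l m ⟩
    ∑ (parts s N) (λ y → 𝟙 (z ▷? y) * chains y l (m + size y))
      ≡⟨ ∑-parts s N _ ⟩
    ∑types s N (λ b k → 𝟙 (z ▷? part b k false) * next b k + 𝟙 (z ▷? part b k true) * chains (part b k true) l (m + b))
      ≡⟨ ∑types-cong s N (λ {b} {k} _ _ → step b k) ⟩
    ∑types s N (λ b k → 2 * (below b k a i * next b k) + same b k a i * next b k)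
      ≡⟨ ∑types-distrib-+ s N _ _ ⟩
    ∑types s N (λ b k → 2 * (below b k a i * next b k)) + ∑types s N (λ b k → same b k a i * next b k)
      ≡⟨ cong₂ _+_ (sym (*-distribˡ-∑types 2 s N _)) (∑types-same s N next a∈ i∈) ⟩
    2 * ∑below a i next + next a i
      ≡⟨ +-comm (2 * ∑below a i next) (next a i) ⟩
    next a i + 2 * ∑below a i next ∎
    where
    open ≡-Reasoning
    z = part a i false
    next : ℕ → ℕ → ℕ
    next b k = plain b k l (m + b)
    regroup : ∀ x y p → (2 * x + y) * p ≡ 2 * (x * p) + y * p
    regroup = solve-∀
    step : ∀ b k → 𝟙 (z ▷? part b k false) * next b k + 𝟙 (z ▷? part b k true) * chains (part b k true) l (m + b)
                   ≡ 2 * (below b k a i * next b k) + same b k a i * next b k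
    step b k = begin
      u * next b k + v * chains (part b k true) l (m + b)
        ≡⟨ cong (λ e → u * next b k + v * e) (chains-overlined b k l (m + b)) ⟩
      u * next b k + v * next b k                       ≡⟨ *-distribʳ-+ (next b k) u v ⟨
      (u + v) * next b k                             ≡⟨ cong (_* next b k) (followers a i false b k) ⟩
      (2 * below b k a i + same b k a i) * next b k ≡⟨ regroup (below b k a i) _ _ ⟩
      2 * (below b k a i * next b k) + same b k a i * next b k ∎
      where
      u = 𝟙 (z ▷? part b k false)
      v = 𝟙 (z ▷? part b k true)

  -- Only the chain without a change of type survives: `l` further copies of the same plain part.
  plain-mod-2 : ∀ {a i} l m → a ∈ sizes N → i ∈ upTo (colours s a) → plain a i l m ≈ h (m + l * a) [mod 2 ]
  plain-mod-2 {a} {i} zero    m a∈ i∈ = ≈-reflexive (trans (+-identityʳ _) (*-identityˡ _))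
  plain-mod-2 {a} {i} (suc l) m a∈ i∈ = ≈-trans (≈-reflexive (plain-suc l m a∈ i∈))
    (≈-trans (≈-+ (plain-mod-2 l (m + a) a∈ i∈) (∣⇒≈0 (m∣m*n (∑below a i λ b k → plain b k l (m + b)))))
             (≈-reflexive (trans (+-identityʳ _) (cong h (+-assoc m a (l * a))))))

  -- Weighs the chains with exactly one change of type: further copies of `(a , i)`, possibly none,
  -- then at least one copy of a smaller `(b , k)`, `l` parts in all. The second summand is the case
  -- of an immediate change.
  twoRuns : ℕ → ℕ → ℕ → ℕ → ℕ
  twoRuns a i zero    m = 0
  twoRuns a i (suc l) m = twoRuns a i l (m + a) + ∑below a i (λ b k → h (m + suc l * b))

  -- What follows a change of type carries a factor 2 already, so there `plain-mod-2` is precise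
  -- enough.
  plain-mod-4 : ∀ {a i} l m → a ∈ sizes N → i ∈ upTo (colours s a) →
    plain a i l m ≈ h (m + l * a) + 2 * twoRuns a i l m [mod 4 ]
  plain-mod-4 {a} {i} zero    m a∈ i∈ =
    ≈-reflexive (trans (+-identityʳ _) (trans (*-identityˡ _) (sym (+-identityʳ _))))
  plain-mod-4 {a} {i} (suc l) m a∈ i∈ = ≈-trans (≈-reflexive (plain-suc l m a∈ i∈))
    (≈-trans (≈-+ (plain-mod-4 l (m + a) a∈ i∈)
                  (≈-scale 2 (≈-∑below a i λ {b} b∈ k∈ → plain-mod-2 l (m + b) b∈ k∈)))
             (≈-reflexive (begin
      h (m + a + l * a) + 2 * t + 2 * ∑below a i (λ b k → h (m + b + l * b))
        ≡⟨ cong₂ (λ e f → h e + 2 * t + 2 * f) (+-assoc m a (l * a))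
             (∑below-cong a i λ {b} _ _ → cong h (+-assoc m b (l * b))) ⟩
      h (m + suc l * a) + 2 * t + 2 * u
        ≡⟨ regroup (h (m + suc l * a)) t u ⟩
      h (m + suc l * a) + 2 * (t + u) ∎)))
    where
    open ≡-Reasoning
    t = twoRuns a i l (m + a)
    u = ∑below a i (λ b k → h (m + suc l * b))
    regroup : ∀ x t u → x + 2 * t + 2 * u ≡ x + 2 * (t + u)
    regroup = solve-∀

  module _ (h-vanishes : ∀ {n} → N < n → h n ≡ 0) where

    ∑-twoRuns : ∀ {a} i → a ∈ sizes N → ∀ L m → L ≤ N → N < L + m →
      ∑ (upTo L) (λ l → twoRuns a i l m)
        ≡ ∑ (upTo L) (λ x → ∑ (sizes N) (λ y → ∑below a i (λ b k → h (m + x * a + y * b))))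
    ∑-twoRuns     i a∈ zero    m L≤N N<L = refl
    ∑-twoRuns {a} i a∈ (suc L) m L≤N N<L = begin
      ∑ (upTo (suc L)) (λ l → twoRuns a i l m)
        ≡⟨ ∑-upTo-suc L (λ l → twoRuns a i l m) ⟩
      ∑ (upTo L) (λ l → twoRuns a i l (m + a) + F (suc l))
        ≡⟨ ∑-distrib-+ (upTo L) _ (F ∘ suc) ⟩
      ∑ (upTo L) (λ l → twoRuns a i l (m + a)) + ∑ (upTo L) (F ∘ suc)
        ≡⟨ cong₂ _+_ (∑-twoRuns i a∈ L (m + a) (≤-trans (n≤1+n L) L≤N) bound) (sym extend) ⟩
      ∑ (upTo L) (λ x → ∑ (sizes N) (G (m + a + x * a))) + ∑ (sizes N) F
        ≡⟨ +-comm (∑ (upTo L) _) (∑ (sizes N) F) ⟩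
      ∑ (sizes N) F + ∑ (upTo L) (λ x → ∑ (sizes N) (G (m + a + x * a)))
        ≡⟨ cong₂ _+_ (∑-cong (sizes N) λ {y} _ → cong (λ e → G e y) (sym (+-identityʳ m)))
                     (∑-cong (upTo L) λ {x} _ → cong (λ e → ∑ (sizes N) (G e)) (+-assoc m a (x * a))) ⟩
      ∑ (sizes N) (G (m + 0)) + ∑ (upTo L) (λ x → ∑ (sizes N) (G (m + suc x * a)))
        ≡⟨ ∑-upTo-suc L (λ x → ∑ (sizes N) (G (m + x * a))) ⟨
      ∑ (upTo (suc L)) (λ x → ∑ (sizes N) (G (m + x * a))) ∎
      where
      open ≡-Reasoning
      G : ℕ → ℕ → ℕ
      G n y = ∑below a i (λ b k → h (n + y * b))
      F = G m
      bound : N < L + (m + a)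
      bound = ≤-trans N<L (≤-trans (≤-reflexive (sym (+-suc L m)))
        (+-monoʳ-≤ L (≤-trans (≤-reflexive (+-comm 1 m)) (+-monoʳ-≤ m (proj₁ (∈-sizes⁻ a∈))))))
      F-vanishes : ∀ {y} → L < y → F y ≡ 0
      F-vanishes {y} L<y = ∑-zero (sizes N) λ {b} b∈ → ∑-zero (upTo (colours s b)) λ {k} _ →
        trans (cong (below b k a i *_) (h-vanishes (<-≤-trans N<L
                (≤-trans (≤-reflexive (+-comm (suc L) m)) (+-monoʳ-≤ m
                  (≤-trans L<y (m≤m*n y b {{>-nonZero (proj₁ (∈-sizes⁻ b∈))}})))))))
              (*-zeroʳ (below b k a i))
      extend : ∑ (sizes N) F ≡ ∑ (upTo L) (F ∘ suc)
      extend = ∑-reindex suc (sizes-unique N) (upTo⁺ L) suc-injective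
        (λ l∈ → inj₁ (∈-map⁺ suc (∈-upTo⁺ (≤-trans (∈-upTo⁻ l∈) (≤-trans (n≤1+n L) L≤N)))))
        onto
        where
        onto : ∀ {y} → y ∈ sizes N → (∃ λ c → c ∈ upTo L × y ≡ suc c) ⊎ F y ≡ 0
        onto y∈ with ∈-map⁻ suc y∈
        ... | c , _ , refl with c <? L
        ...   | yes c<L = inj₁ (c , ∈-upTo⁺ c<L , refl)
        ...   | no c≮L  = inj₂ (F-vanishes (s≤s (≮⇒≥ c≮L)))

-- Reduction modulo 8 to partitions with one or two different parts

module ElementaryCounts (s N : ℕ) where

  h : ℕ → ℕ
  h m = 𝟙 (m ≟ N)

  open Chains s N h

  e₁ : ℕ
  e₁ = ∑ (sizes N) λ l → ∑types s N λ a i → h (l * a)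

  -- Taking `(b , k)` below `(a , i)` counts each unordered pair of types once; `x` and `y` are the
  -- multiplicities.
  e₂ : ℕ
  e₂ = ∑types s N λ a i → ∑ (sizes N) λ x → ∑ (sizes N) λ y → ∑below a i λ b k → h (x * a + y * b)

  -- The factor 2 is the overlining of the first part listed, which has no influence on what may
  -- follow. The empty word has total 0 and drops out.
  ā-as-chains : 0 < N → ā s N ≡ 2 * ∑ (upTo N) (λ l → ∑types s N (λ a i → plain a i l a))
  ā-as-chains 0<N = begin
    ā s N                                                        ≡⟨ length-filter≡∑ (isOverpartition? N) (candidates s N) ⟩
    ∑ (candidates s N) g                                         ≡⟨ ∑-concatMap (λ l → words l (parts s N)) (upTo (suc N)) g ⟩
    ∑ (upTo (suc N)) (λ l → ∑ (words l (parts s N)) g)           ≡⟨ ∑-upTo-suc N _ ⟩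
    (g [] + 0) + ∑ (upTo N) (λ l → ∑ (words (suc l) (parts s N)) g)
      ≡⟨ cong₂ _+_ (trans (+-identityʳ _) (trans (𝟙-× (linked? _▷?_ []) (0 ≟ N)) (cong (1 *_) (𝟙-no (0 ≟ N) (<⇒≢ 0<N)))))
                   (∑-cong (upTo N) λ {l} _ → nonempty l) ⟩
    ∑ (upTo N) (λ l → 2 * ∑types s N (λ a i → plain a i l a))    ≡⟨ *-distribˡ-∑ 2 (upTo N) _ ⟨
    2 * ∑ (upTo N) (λ l → ∑types s N (λ a i → plain a i l a))    ∎
    where
    open ≡-Reasoning
    g : List Part → ℕ
    g = 𝟙 ∘ isOverpartition? N
    nonempty : ∀ l → ∑ (words (suc l) (parts s N)) g ≡ 2 * ∑types s N (λ a i → plain a i l a)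
    nonempty l = begin
      ∑ (words (suc l) (parts s N)) g
        ≡⟨ ∑-cartesianProductWith _∷_ (parts s N) (words l (parts s N)) g ⟩
      ∑ (parts s N) (λ y → ∑ (words l (parts s N)) (λ w → g (y ∷ w)))
        ≡⟨ ∑-cong (parts s N) (λ {y} _ → ∑-cong (words l (parts s N)) λ {w} _ →
             𝟙-× (linked? _▷?_ (y ∷ w)) (size y + sum (map size w) ≟ N)) ⟩
      ∑ (parts s N) (λ y → chains y l (size y))
        ≡⟨ ∑-parts s N _ ⟩
      ∑types s N (λ a i → plain a i l a + chains (part a i true) l a)
        ≡⟨ ∑types-cong s N (λ {a} {i} _ _ → cong (plain a i l a +_)
             (trans (chains-overlined a i l a) (sym (+-identityʳ _)))) ⟩
      ∑types s N (λ a i → 2 * plain a i l a)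
        ≡⟨ *-distribˡ-∑types 2 s N _ ⟨
      2 * ∑types s N (λ a i → plain a i l a) ∎

  -- The factor 2 of the first part lifts `plain-mod-4` to modulus 8. Chains without a change of
  -- type give `e₁`, those with one change give `e₂`.
  ā-mod-8 : 0 < N → ā s N ≈ 2 * (e₁ + 2 * e₂) [mod 8 ]
  ā-mod-8 0<N = ≈-trans (≈-reflexive (ā-as-chains 0<N)) (≈-scale 2 (≈-trans
    (≈-∑ (upTo N) λ {l} _ → ≈-∑types s N λ {a} {i} a∈ i∈ → plain-mod-4 l a a∈ i∈)
    (≈-reflexive (begin
      ∑ (upTo N) (λ l → ∑types s N (λ a i → h (a + l * a) + 2 * twoRuns a i l a))
        ≡⟨ ∑-cong (upTo N) (λ {l} _ → trans (∑types-distrib-+ s N (λ a i → h (suc l * a)) (λ a i → 2 * twoRuns a i l a))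
             (cong (H l +_) (sym (*-distribˡ-∑types 2 s N (λ a i → twoRuns a i l a))))) ⟩
      ∑ (upTo N) (λ l → H l + 2 * T l)
        ≡⟨ trans (∑-distrib-+ (upTo N) H _) (cong (∑ (upTo N) H +_) (sym (*-distribˡ-∑ 2 (upTo N) T))) ⟩
      ∑ (upTo N) H + 2 * ∑ (upTo N) T
        ≡⟨ cong₂ (λ e f → e + 2 * f) (sym (∑-map suc (upTo N) _)) runs ⟩
      e₁ + 2 * e₂ ∎))))
    where
    open ≡-Reasoning
    H T : ℕ → ℕ
    H l = ∑types s N λ a i → h (suc l * a)
    T l = ∑types s N λ a i → twoRuns a i l a
    runs : ∑ (upTo N) T ≡ e₂
    -- The first part is already contained in `m = a`, so `x` further copies mean multiplicity
    -- `suc x`; this shifts `upTo N` to `sizes N`.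
    runs = trans (∑-∑types-swap s N (upTo N) _) (∑types-cong s N λ {a} {i} a∈ _ → trans
      (∑-twoRuns (λ N<n → 𝟙-no (_ ≟ N) (≢-sym (<⇒≢ N<n))) i a∈ N a ≤-refl
        (m<m+n N (proj₁ (∈-sizes⁻ a∈))))
      (sym (∑-map suc (upTo N) _)))

-- Parity of the elementary counts at N = 2 M

colours-even : ∀ s {a} → 2 ∣ a → colours s a ≡ 1
colours-even s {a} 2∣a = cong (if_then 1 else s) (trans (isYes≗does (2 ∣? a)) (dec-true (2 ∣? a) 2∣a))

colours-odd : ∀ s {a} → 2 ∤ a → colours s a ≡ s
colours-odd s {a} 2∤a = cong (if_then 1 else s) (trans (isYes≗does (2 ∣? a)) (dec-false (2 ∣? a) 2∤a))

-- A size has 1 or `2 * β + 1` colours, both odd. Modulo 2 a sum of equal terms over the colours is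
-- therefore a single term.
colours-odd-number : ∀ β a → colours (2 * β + 1) a ≈ 1 [mod 2 ]
colours-odd-number β a = by-cases (2 ∣? a)
  where
  by-cases : Dec (2 ∣ a) → colours (2 * β + 1) a ≈ 1 [mod 2 ]
  by-cases (yes 2∣a) = ≈-reflexive (colours-even (2 * β + 1) 2∣a)
  by-cases (no  2∤a) = ≈-trans (≈-reflexive (colours-odd (2 * β + 1) 2∤a))
    (0 , β , trans (+-identityʳ (2 * β + 1)) (trans (+-comm (2 * β) 1) (cong suc (*-comm 2 β))))

module _ {M : ℕ} (2∤M : 2 ∤ M) (M≢□ : ∀ m → m * m ≢ M) where

  private
    N = 2 * M

    h : ℕ → ℕ
    h m = 𝟙 (m ≟ N)

    h-vanishes : ∀ {m} → m ≢ N → h m ≡ 0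
    h-vanishes {m} = 𝟙-no (m ≟ N)

    h-beyond : ∀ {x m} → 1 ≤ x → N < m → h (x * m) ≡ 0
    h-beyond {x} {m} 1≤x N<m = h-vanishes (≢-sym (<⇒≢ (<-≤-trans N<m (m≤n*m m x {{>-nonZero 1≤x}}))))

    h-double : ∀ m → h (2 * m) ≡ 𝟙 (m ≟ M)
    h-double m = 𝟙-cong (2 * m ≟ N) (m ≟ M) (*-cancelˡ-≡ m M 2) (cong (2 *_))

  -- Exchanging `x` and `y` pairs off the solutions; a fixed point would make `M` a square. The
  -- constant `c` is later 1 or a number of pairs of colours.
  factor-pairs-even : ∀ (xs : List ℕ) c → ∑ xs (λ x → ∑ xs λ y → c * 𝟙 (x * y ≟ M)) ≈ 0 [mod 2 ]
  factor-pairs-even xs c = ≈-trans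
    (∑-symmetric xs (λ x y → c * 𝟙 (x * y ≟ M)) λ x y → cong (λ e → c * 𝟙 (e ≟ M)) (*-comm x y))
    (≈-reflexive (∑-zero xs λ {x} _ → trans (cong (c *_) (𝟙-no (x * x ≟ M) (M≢□ x))) (*-zeroʳ c)))

  odd-cofactor : ∀ {l a} → l * a ≡ N → 2 ∣ a → 2 ∤ l
  odd-cofactor {l} la≡N (divides q refl) 2∣l = 2∤M (subst (2 ∣_) lq≡M (∣m⇒∣m*n q 2∣l))
    where
    move : ∀ l q → 2 * (l * q) ≡ l * (q * 2)
    move = solve-∀
    lq≡M : l * q ≡ M
    lq≡M = *-cancelˡ-≡ (l * q) M 2 (trans (move l q) la≡N)

  even-cofactor : ∀ {l a} → l * a ≡ N → 2 ∤ a → 2 ∣ l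
  even-cofactor {l} {a} la≡N 2∤a with euclidsLemma l a prime[2] (subst (2 ∣_) (sym la≡N) (m∣m*n M))
  ... | inj₁ 2∣l = 2∣l
  ... | inj₂ 2∣a = contradiction 2∣a 2∤a

  -- The number of even divisors `a` of `N`, which is the number of divisors of `M`. The cofactor
  -- `l` stays a variable so that `l` and `a` can trade places.
  evenDivisors : ℕ
  evenDivisors = ∑ (sizes N) λ l → ∑ (sizes N) λ a → 𝟙 (2 ∣? a) * h (l * a)

  -- Writing `a = 2 * c` turns `l * a ≡ N` into `l * c ≡ M`, whose solutions pair off. Values
  -- `2 * c` beyond `N` contribute 0.
  evenDivisors-even : evenDivisors ≈ 0 [mod 2 ]
  evenDivisors-even = ≈-trans (≈-reflexive (∑-cong (sizes N) halve)) (factor-pairs-even (sizes N) 1)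
    where
    double : ∀ l c → l * (2 * c) ≡ 2 * (l * c)
    double = solve-∀
    halve : ∀ {l} → l ∈ sizes N →
      ∑ (sizes N) (λ a → 𝟙 (2 ∣? a) * h (l * a)) ≡ ∑ (sizes N) (λ c → 1 * 𝟙 (l * c ≟ M))
    halve {l} l∈ = trans
      (∑-reindex (2 *_) (sizes-unique N) (sizes-unique N) (λ {c} {d} → *-cancelˡ-≡ c d 2) into onto)
      (∑-cong (sizes N) λ {c} _ → cong₂ _*_ (𝟙-yes (2 ∣? 2 * c) (m∣m*n c))
        (trans (cong h (double l c)) (h-double (l * c))))
      where
      into : ∀ {c} → c ∈ sizes N → 2 * c ∈ sizes N ⊎ 𝟙 (2 ∣? 2 * c) * h (l * (2 * c)) ≡ 0
      into {c} c∈ with 2 * c ≤? N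
      ... | yes 2c≤N = inj₁ (∈-sizes⁺ (≤-trans (proj₁ (∈-sizes⁻ c∈)) (m≤n*m c 2)) 2c≤N)
      ... | no  2c≰N = inj₂ (trans (cong (𝟙 (2 ∣? 2 * c) *_) (h-beyond (proj₁ (∈-sizes⁻ l∈)) (≰⇒> 2c≰N)))
                                   (*-zeroʳ (𝟙 (2 ∣? 2 * c))))
      onto : ∀ {a} → a ∈ sizes N → (∃ λ c → c ∈ sizes N × a ≡ 2 * c) ⊎ 𝟙 (2 ∣? a) * h (l * a) ≡ 0
      onto {a} a∈ with 2 ∣? a
      ... | no  2∤a = inj₂ (cong (_* h (l * a)) (𝟙-no (2 ∣? a) 2∤a))
      ... | yes (divides zero    refl) = contradiction (proj₁ (∈-sizes⁻ a∈)) λ ()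
      ... | yes (divides (suc q) refl) = inj₁ (suc q ,
        ∈-sizes⁺ (s≤s z≤n) (≤-trans (m≤m*n (suc q) 2) (proj₂ (∈-sizes⁻ a∈))) , *-comm (suc q) 2)

  module _ (s : ℕ) where
    open ElementaryCounts s N using (e₁; e₂)

    -- N is twice an odd number, so of two cofactors exactly one is even.
    e₁≡[1+s]*evenDivisors : e₁ ≡ suc s * evenDivisors
    e₁≡[1+s]*evenDivisors = begin
      e₁
        ≡⟨ ∑-cong (sizes N) (λ {l} _ → ∑-cong (sizes N) λ {a} _ → trans
             (∑-const (upTo (colours s a)) _) (trans (cong (_* h (l * a)) (length-upTo (colours s a))) (split l a))) ⟩
      ∑ (sizes N) (λ l → ∑ (sizes N) λ a → v a * h (l * a) + s * (v l * h (l * a)))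
        ≡⟨ trans (∑-cong (sizes N) λ {l} _ → ∑-distrib-+ (sizes N) (λ a → v a * h (l * a)) _)
                 (∑-distrib-+ (sizes N) (λ l → ∑ (sizes N) λ a → v a * h (l * a)) _) ⟩
      evenDivisors + ∑ (sizes N) (λ l → ∑ (sizes N) λ a → s * (v l * h (l * a)))
        ≡⟨ cong (evenDivisors +_) (sym (trans
             (*-distribˡ-∑ s (sizes N) (λ l → ∑ (sizes N) λ a → v l * h (l * a)))
             (∑-cong (sizes N) λ {l} _ → *-distribˡ-∑ s (sizes N) (λ a → v l * h (l * a))))) ⟩
      evenDivisors + s * ∑ (sizes N) (λ l → ∑ (sizes N) λ a → v l * h (l * a))
        -- Trading the names of the two cofactors turns the sum over even `l` into `evenDivisors`.
        ≡⟨ cong (λ e → evenDivisors + s * e) (trans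
             (∑-swap (sizes N) (sizes N) (λ l a → v l * h (l * a)))
             (∑-cong (sizes N) λ {a} _ → ∑-cong (sizes N) λ {l} _ → cong (λ e → v l * h e) (*-comm l a))) ⟩
      suc s * evenDivisors ∎
      where
      open ≡-Reasoning
      v : ℕ → ℕ
      v a = 𝟙 (2 ∣? a)
      -- When `l * a ≡ N`, an even `a` has one colour and an odd cofactor, an odd `a` has `s`
      -- colours and an even cofactor: exactly one indicator on the right is 1.
      split : ∀ l a → colours s a * h (l * a) ≡ v a * h (l * a) + s * (v l * h (l * a))
      split l a = by-cases (l * a ≟ N) (2 ∣? a)
        where
        off : h (l * a) ≡ 0 → colours s a * h (l * a) ≡ v a * h (l * a) + s * (v l * h (l * a))
        off h≡0 rewrite h≡0 | *-zeroʳ (colours s a) | *-zeroʳ (v a) | *-zeroʳ (v l) = sym (*-zeroʳ s)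
        by-cases : Dec (l * a ≡ N) → Dec (2 ∣ a) → colours s a * h (l * a) ≡ v a * h (l * a) + s * (v l * h (l * a))
        by-cases (no la≢N)  _ = off (h-vanishes la≢N)
        by-cases (yes la≡N) (yes 2∣a)
          rewrite colours-even s 2∣a | 𝟙-yes (2 ∣? a) 2∣a | 𝟙-no (2 ∣? l) (odd-cofactor {l} la≡N 2∣a) | *-zeroʳ s
          = sym (+-identityʳ _)
        by-cases (yes la≡N) (no 2∤a)
          rewrite colours-odd s 2∤a | 𝟙-no (2 ∣? a) 2∤a | 𝟙-yes (2 ∣? l) (even-cofactor {l} la≡N 2∤a)
          = cong (s *_) (sym (+-identityʳ _))

  -- Conjugation in disguise: with a = b + c the equation x a + y b = N is symmetric
  -- under (x , y) ↔ (b , c), and a fixed point would make N divisible by 4.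
  distinct-sizes-even :
    ∑ (sizes N) (λ a → ∑ (sizes N) λ x → ∑ (sizes N) λ y → ∑ (sizes N) λ b → 𝟙 (b <? a) * h (x * a + y * b))
      ≈ 0 [mod 2 ]
  distinct-sizes-even = ≈-trans (≈-reflexive reorder)
    (≈-trans (∑-symmetric (cartesianProduct (sizes N) (sizes N)) g g-sym)
             (≈-reflexive (∑-zero (cartesianProduct (sizes N) (sizes N)) λ {p} _ → diagonal p)))
    where
    open ≡-Reasoning
    R = sizes N
    f : ℕ → ℕ → ℕ → ℕ → ℕ
    f a x y b = 𝟙 (b <? a) * h (x * a + y * b)

    -- `(x , y)` are the multiplicities, `(b , c)` the smaller size and its gap to the larger one.
    -- With this grouping the involution swaps the two arguments.
    g : ℕ × ℕ → ℕ × ℕ → ℕ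
    g (x , y) (b , c) = h (x * (b + c) + y * b)

    g-sym : ∀ p q → g p q ≡ g q p
    g-sym (x , y) (b , c) = cong h (swap x y b c)
      where
      swap : ∀ x y b c → x * (b + c) + y * b ≡ b * (x + y) + c * x
      swap = solve-∀

    diagonal : ∀ p → g p p ≡ 0
    diagonal (x , y) = h-vanishes contra
      where
      expand : ∀ x y → x * (x + y) + y * x ≡ 2 * (x * y) + x * x
      expand = solve-∀
      quarter : ∀ q y → q * 2 * (q * 2 + y) + y * (q * 2) ≡ 2 * (2 * (q * q + q * y))
      quarter = solve-∀
      contra : x * (x + y) + y * x ≢ N
      -- Modulo 2 the expanded left side is `x * x`, so `x` is even; then the left side is a
      -- multiple of 4, against `2 ∤ M`.
      contra eq with 2∣x
        where
        2∣x² : 2 ∣ x * x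
        2∣x² = ∣m+n∣m⇒∣n (subst (2 ∣_) (trans (sym eq) (expand x y)) (m∣m*n M)) (m∣m*n (x * y))
        2∣x : 2 ∣ x
        2∣x with euclidsLemma x x prime[2] 2∣x²
        ... | inj₁ d = d
        ... | inj₂ d = d
      ... | divides q refl = 2∤M (subst (2 ∣_) (*-cancelˡ-≡ _ M 2 (trans (sym (quarter q y)) eq)) (m∣m*n (q * q + q * y)))

    -- The condition `b < a` becomes the range `c ≥ 1` of the gap. A size `b + c` above `N`
    -- overshoots because `x ≥ 1`.
    shift : ∀ {x} y {b} → x ∈ R → b ∈ R → ∑ R (λ a → f a x y b) ≡ ∑ R (λ c → g (x , y) (b , c))
    shift {x} y {b} x∈ b∈ = trans
      (∑-reindex (b +_) (sizes-unique N) (sizes-unique N) (λ {c} {d} → +-cancelˡ-≡ b c d) into onto)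
      (∑-cong R λ {c} c∈ → trans (cong (_* h (x * (b + c) + y * b)) (𝟙-yes (b <? b + c) (m<m+n b (proj₁ (∈-sizes⁻ c∈)))))
                                 (*-identityˡ _))
      where
      into : ∀ {c} → c ∈ R → b + c ∈ R ⊎ f (b + c) x y b ≡ 0
      into {c} c∈ with b + c ≤? N
      ... | yes b+c≤N = inj₁ (∈-sizes⁺ (≤-trans (proj₁ (∈-sizes⁻ b∈)) (m≤m+n b c)) b+c≤N)
      ... | no  b+c≰N = inj₂ (trans (cong (𝟙 (b <? b + c) *_) (h-vanishes (≢-sym (<⇒≢ (<-≤-trans (≰⇒> b+c≰N)
        (≤-trans (m≤n*m (b + c) x {{>-nonZero (proj₁ (∈-sizes⁻ x∈))}}) (m≤m+n _ _)))))))
        (*-zeroʳ (𝟙 (b <? b + c))))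
      onto : ∀ {a} → a ∈ R → (∃ λ c → c ∈ R × a ≡ b + c) ⊎ f a x y b ≡ 0
      onto {a} a∈ = by-cases (b <? a)
        where
        by-cases : Dec (b < a) → (∃ λ c → c ∈ R × a ≡ b + c) ⊎ f a x y b ≡ 0
        by-cases (yes b<a) = inj₁ (a ∸ b , ∈-sizes⁺ (m<n⇒0<n∸m b<a) (≤-trans (m∸n≤m a b) (proj₂ (∈-sizes⁻ a∈)))
                                  , sym (m+[n∸m]≡n (<⇒≤ b<a)))
        by-cases (no b≮a)  = inj₂ (cong (_* h (x * a + y * b)) (𝟙-no (b <? a) b≮a))

    reorder : ∑ R (λ a → ∑ R λ x → ∑ R λ y → ∑ R λ b → f a x y b)
              ≡ ∑ (cartesianProduct R R) (λ p → ∑ (cartesianProduct R R) (g p))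
    reorder = begin
      ∑ R (λ a → ∑ R λ x → ∑ R λ y → ∑ R λ b → f a x y b)
        ≡⟨ ∑-swap R R _ ⟩
      ∑ R (λ x → ∑ R λ a → ∑ R λ y → ∑ R λ b → f a x y b)
        ≡⟨ ∑-cong R (λ _ → ∑-swap R R _) ⟩
      ∑ R (λ x → ∑ R λ y → ∑ R λ a → ∑ R λ b → f a x y b)
        ≡⟨ ∑-cong R (λ _ → ∑-cong R λ _ → ∑-swap R R _) ⟩
      ∑ R (λ x → ∑ R λ y → ∑ R λ b → ∑ R λ a → f a x y b)
        ≡⟨ ∑-cong R (λ x∈ → ∑-cong R λ {y} _ → ∑-cong R λ b∈ → shift y x∈ b∈) ⟩
      ∑ R (λ x → ∑ R λ y → ∑ R λ b → ∑ R λ c → g (x , y) (b , c))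
        ≡⟨ ∑-cong R (λ {x} _ → ∑-cong R λ {y} _ → ∑-cartesianProductWith _,_ R R (g (x , y))) ⟨
      ∑ R (λ x → ∑ R λ y → ∑ (cartesianProduct R R) (g (x , y)))
        ≡⟨ ∑-cartesianProductWith _,_ R R _ ⟨
      ∑ (cartesianProduct R R) (λ p → ∑ (cartesianProduct R R) (g p)) ∎

  module _ (β : ℕ) where
    private
      s = 2 * β + 1
      R = sizes N

    open ElementaryCounts s N using (e₁; e₂)
    open Chains s N h using (∑below)

    smallerColours : ℕ → ℕ → ℕ
    smallerColours a i = ∑ (upTo (colours s a)) λ k → 𝟙 (k <? i)

    -- A type below `(a , i)` has a smaller size, and then its odd number of colours collapses to
    -- one term, or it has size `a` and a smaller colour.
    ∑below-mod-2 : ∀ {a} i x y → a ∈ R → ∑below a i (λ b k → h (x * a + y * b))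
      ≈ ∑ R (λ b → 𝟙 (b <? a) * h (x * a + y * b)) + smallerColours a i * h (x * a + y * a) [mod 2 ]
    ∑below-mod-2 {a} i x y a∈ = ≈-trans
      (≈-reflexive (trans
        (∑types-cong s N λ {b} {k} _ _ → *-distribʳ-+ (H b) (𝟙 (b <? a)) (𝟙 (b ≟ a) * 𝟙 (k <? i)))
        (∑types-distrib-+ s N (λ b k → 𝟙 (b <? a) * H b) (λ b k → 𝟙 (b ≟ a) * 𝟙 (k <? i) * H b))))
      (≈-+ (≈-∑ R λ {b} _ → smaller b) (≈-reflexive equal-size))
      where
      H : ℕ → ℕ
      H b = h (x * a + y * b)
      smaller : ∀ b → ∑ (upTo (colours s b)) (λ k → 𝟙 (b <? a) * H b) ≈ 𝟙 (b <? a) * H b [mod 2 ]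
      smaller b = ≈-trans (≈-reflexive (trans (∑-const (upTo (colours s b)) (𝟙 (b <? a) * H b))
          (trans (cong (_* (𝟙 (b <? a) * H b)) (length-upTo (colours s b))) (*-comm (colours s b) _))))
        (≈-trans (≈-*ˡ (𝟙 (b <? a) * H b) (colours-odd-number β b)) (≈-reflexive (*-identityʳ _)))
      equal-size : ∑types s N (λ b k → 𝟙 (b ≟ a) * 𝟙 (k <? i) * H b) ≡ smallerColours a i * H a
      equal-size = begin
        ∑types s N (λ b k → 𝟙 (b ≟ a) * 𝟙 (k <? i) * H b)
          ≡⟨ ∑-single (sizes-unique N) a∈ (λ {b} _ b≢a → ∑-zero (upTo (colours s b)) λ {k} _ →
               cong (λ e → e * 𝟙 (k <? i) * H b) (𝟙-no (b ≟ a) b≢a)) ⟩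
        ∑ (upTo (colours s a)) (λ k → 𝟙 (a ≟ a) * 𝟙 (k <? i) * H a)
          ≡⟨ ∑-cong (upTo (colours s a)) (λ {k} _ → trans
               (cong (λ e → e * 𝟙 (k <? i) * H a) (𝟙-yes (a ≟ a) refl))
               (trans (cong (_* H a) (*-identityˡ (𝟙 (k <? i)))) (*-comm (𝟙 (k <? i)) (H a)))) ⟩
        ∑ (upTo (colours s a)) (λ k → H a * 𝟙 (k <? i))
          ≡⟨ *-distribˡ-∑ (H a) (upTo (colours s a)) (λ k → 𝟙 (k <? i)) ⟨
        H a * smallerColours a i
          ≡⟨ *-comm (H a) _ ⟩
        smallerColours a i * H a ∎
        where open ≡-Reasoning

    -- The binomial coefficient `c` over 2.
    colourPairs : ℕ → ℕ
    colourPairs c = ∑ (upTo c) λ i → ∑ (upTo c) λ k → 𝟙 (k <? i)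

    -- Exchanging the multiplicities leaves the terms with `x = y`, where `2 * (a * x) ≡ N`, that is
    -- `a * x ≡ M`. Every such `a` has the same number of pairs of colours, so `factor-pairs-even`
    -- applies.
    equal-sizes-even : ∑types s N (λ a i → ∑ R λ x → ∑ R λ y → smallerColours a i * h (x * a + y * a)) ≈ 0 [mod 2 ]
    equal-sizes-even = ≈-trans
      (≈-∑types s N λ {a} {i} _ _ → ∑-symmetric R (λ x y → smallerColours a i * h (x * a + y * a))
        λ x y → cong (λ e → smallerColours a i * h e) (+-comm (x * a) (y * a)))
      (≈-trans (≈-reflexive (∑-cong R λ {a} _ → trans (∑-swap (upTo (colours s a)) R _) (∑-cong R λ {x} _ → collect a x)))
               (factor-pairs-even R (colourPairs s)))
      where
      open ≡-Reasoning
      double : ∀ x a → x * a + x * a ≡ 2 * (a * x)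
      double = solve-∀
      collect : ∀ a x → ∑ (upTo (colours s a)) (λ i → smallerColours a i * h (x * a + x * a))
                        ≡ colourPairs s * 𝟙 (a * x ≟ M)
      collect a x = begin
        ∑ (upTo (colours s a)) (λ i → smallerColours a i * h (x * a + x * a))
          ≡⟨ ∑-cong (upTo (colours s a)) (λ {i} _ → trans
               (cong (smallerColours a i *_) (trans (cong h (double x a)) (h-double (a * x))))
               (*-comm (smallerColours a i) _)) ⟩
        ∑ (upTo (colours s a)) (λ i → 𝟙 (a * x ≟ M) * smallerColours a i)
          ≡⟨ *-distribˡ-∑ (𝟙 (a * x ≟ M)) (upTo (colours s a)) (smallerColours a) ⟨
        𝟙 (a * x ≟ M) * colourPairs (colours s a)
          ≡⟨ *-comm (𝟙 (a * x ≟ M)) _ ⟩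
        colourPairs (colours s a) * 𝟙 (a * x ≟ M)
          ≡⟨ by-cases (a * x ≟ M) ⟩
        colourPairs s * 𝟙 (a * x ≟ M) ∎
        where
        by-cases : Dec (a * x ≡ M) → colourPairs (colours s a) * 𝟙 (a * x ≟ M) ≡ colourPairs s * 𝟙 (a * x ≟ M)
        -- A factor of the odd number `M` is odd, so `a` comes in `s` colours.
        by-cases (yes ax≡M) = cong (λ c → colourPairs c * 𝟙 (a * x ≟ M))
          (colours-odd s {a} λ 2∣a → 2∤M (subst (2 ∣_) ax≡M (∣m⇒∣m*n x 2∣a)))
        by-cases (no ax≢M) = trans (trans (cong (colourPairs (colours s a) *_) (𝟙-no (a * x ≟ M) ax≢M)) (*-zeroʳ (colourPairs (colours s a))))
          (sym (trans (cong (colourPairs s *_) (𝟙-no (a * x ≟ M) ax≢M)) (*-zeroʳ (colourPairs s))))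

    -- The pairs of types split by distinct and by equal sizes. In the first kind the summand does
    -- not depend on the colour of the larger part, so the sum over its odd number of colours
    -- collapses as well.
    e₂-even : e₂ ≈ 0 [mod 2 ]
    e₂-even = ≈-trans
      (≈-∑types s N λ {a} {i} a∈ _ → ≈-∑ R λ {x} _ → ≈-∑ R λ {y} _ → ∑below-mod-2 i x y a∈)
      (≈-trans (≈-reflexive (trans (∑types-cong s N λ {a} {i} _ _ → distribute a i) (∑types-distrib-+ s N (λ a i → U a) V)))
               (≈-+ (≈-trans (≈-∑ R λ {a} _ → drop-colour a) distinct-sizes-even) equal-sizes-even))
      where
      u : ℕ → ℕ → ℕ → ℕ
      u a x y = ∑ R λ b → 𝟙 (b <? a) * h (x * a + y * b)
      U : ℕ → ℕ
      U a = ∑ R λ x → ∑ R λ y → u a x y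
      V : ℕ → ℕ → ℕ
      V a i = ∑ R λ x → ∑ R λ y → smallerColours a i * h (x * a + y * a)
      distribute : ∀ a i → ∑ R (λ x → ∑ R λ y → u a x y + smallerColours a i * h (x * a + y * a)) ≡ U a + V a i
      distribute a i = trans
        (∑-cong R λ {x} _ → ∑-distrib-+ R (u a x) (λ y → smallerColours a i * h (x * a + y * a)))
        (∑-distrib-+ R (λ x → ∑ R (u a x)) _)
      drop-colour : ∀ a → ∑ (upTo (colours s a)) (λ _ → U a) ≈ U a [mod 2 ]
      drop-colour a = ≈-trans (≈-reflexive (trans (∑-const (upTo (colours s a)) (U a))
          (trans (cong (_* U a) (length-upTo (colours s a))) (*-comm (colours s a) (U a)))))
        (≈-trans (≈-*ˡ (U a) (colours-odd-number β a)) (≈-reflexive (*-identityʳ _)))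

  0<N : 0 < N
  -- Zero is a square, so `M` is positive.
  0<N = *-mono-≤ {1} {2} (s≤s z≤n) (n≢0⇒n>0 (M≢□ 0 ∘ sym))

  -- Modulo 4 it suffices that `e₁ + 2 * e₂` is even, and `e₁` is a multiple of the even number
  -- `evenDivisors`.
  4∣ā : ∀ s → 4 ∣ ā s N
  4∣ā s = ≈0⇒∣ (≈-trans (≈-coarsen 2 (ā-mod-8 0<N)) (≈-scale 2 (≈-+ e₁-even (∣⇒≈0 (m∣m*n e₂)))))
    where
    open ElementaryCounts s N using (e₁; e₂; ā-mod-8)
    e₁-even : e₁ ≈ 0 [mod 2 ]
    e₁-even = ≈-trans (≈-reflexive (e₁≡[1+s]*evenDivisors s))
      (≈-trans (≈-*ˡ (suc s) evenDivisors-even) (≈-reflexive (*-zeroʳ (suc s))))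

  -- Now `e₁ + 2 * e₂` has to vanish modulo 4. In `e₁` one factor 2 comes from `suc s = 2 * β + 2`
  -- and another from `evenDivisors`; `2 * e₂` is covered by `e₂-even`.
  8∣ā : ∀ β → 8 ∣ ā (2 * β + 1) N
  8∣ā β = ≈0⇒∣ (≈-trans (ā-mod-8 0<N) (≈-scale 2 (≈-+ e₁≈0 (≈-scale 2 (e₂-even β)))))
    where
    open ElementaryCounts (2 * β + 1) N using (e₁; ā-mod-8)
    factor : ∀ β d → (2 + 2 * β) * d ≡ 2 * (suc β * d)
    factor = solve-∀
    e₁≈0 : e₁ ≈ 0 [mod 4 ]
    e₁≈0 = ≈-trans
      (≈-reflexive (trans (e₁≡[1+s]*evenDivisors (2 * β + 1))
        (trans (cong (λ e → suc e * evenDivisors) (+-comm (2 * β) 1)) (factor β evenDivisors))))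
      (≈-scale 2 (≈-trans (≈-*ˡ (suc β) evenDivisors-even) (≈-reflexive (*-zeroʳ (suc β)))))

-- Odd parity and non-squareness of `M`

odd-prime-∤2 : ∀ {p} → Prime p → 3 ≤ p → 2 ∤ p
odd-prime-∤2 pp 3≤p 2∣p with prime⇒irreducible pp 2∣p
... | inj₂ refl = contradiction 3≤p λ { (s≤s (s≤s ())) }

prime-∤-^ : ∀ {p q} → Prime q → q ∤ p → ∀ e → q ∤ p ^ e
prime-∤-^ {p} pq q∤p zero    q∣1 = contradiction (∣1⇒≡1 q∣1) λ { refl → ¬prime[1] pq }
prime-∤-^ {p} pq q∤p (suc e) q∣pᵉ with euclidsLemma p (p ^ e) pq q∣pᵉ
... | inj₁ q∣p  = q∤p q∣p
... | inj₂ q∣pᵉ′ = prime-∤-^ pq q∤p e q∣pᵉ′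

-- Descent on `k`: `p` divides `m`, and cancelling `p * p` lowers the exponent by 2. At exponent 1 a
-- factor `p` is left over and would have to divide `w`.
odd-power-not-square : ∀ {p w} → Prime p → p ∤ w → ∀ k m → m * m ≢ p ^ (2 * k + 1) * w
odd-power-not-square {p} {w} pp p∤w k m eq with p∣m
  where
  p∣rhs : p ∣ p ^ (2 * k + 1) * w
  p∣rhs = ∣m⇒∣m*n w (subst (λ e → p ∣ p ^ e) (+-comm 1 (2 * k)) (m∣m*n (p ^ (2 * k))))
  p∣m : p ∣ m
  p∣m with euclidsLemma m m pp (subst (p ∣_) (sym eq) p∣rhs)
  ... | inj₁ d = d
  ... | inj₂ d = d
odd-power-not-square {p} {w} pp p∤w zero .(q * p) eq | divides q refl =
  p∤w (divides (q * q) (*-cancelˡ-≡ w _ p (trans (sym (trans eq (cong (_* w) (*-identityʳ p)))) (regroup p q))))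
  where
  instance _ = prime⇒nonZero pp
  regroup : ∀ p q → q * p * (q * p) ≡ p * (q * q * p)
  regroup = solve-∀
odd-power-not-square {p} {w} pp p∤w (suc k) .(q * p) eq | divides q refl =
  odd-power-not-square pp p∤w k q (*-cancelˡ-≡ (q * q) _ p (*-cancelˡ-≡ (p * (q * q)) _ p
    (trans (regroup p q) (trans eq (trans (cong (λ e → p ^ e * w) (exponent k)) (assoc p (p ^ (2 * k + 1)) w))))))
  where
  instance _ = prime⇒nonZero pp
  regroup : ∀ p q → p * (p * (q * q)) ≡ q * p * (q * p)
  regroup = solve-∀
  exponent : ∀ k → 2 * suc k + 1 ≡ 2 + (2 * k + 1)
  exponent = solve-∀
  assoc : ∀ p e w → p * (p * e) * w ≡ p * (p * (e * w))
  assoc = solve-∀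

theorem1p7 : (p α β : ℕ) → Prime p → 3 ≤ p → 1 ≤ α → 1 ≤ β →
    (2 ∣ ā (2 * α) (2 * p) →
    (n k : ℕ) → p ∤ (2 * n + 1) →
    4 ∣ ā (2 * α) (4 * p ^ (2 * k + 1) * n + 2 * p ^ (2 * k + 1)))
    ×
    (2 ∣ ā (2 * β + 1) (2 * p) →
    (n k : ℕ) → p ∤ (2 * n + 1) →
    8 ∣ ā (2 * β + 1) (4 * p ^ (2 * k + 1) * n + 2 * p ^ (2 * k + 1)))
theorem1p7 p α β pp 3≤p _ _ =
  (λ _ n k p∤2n+1 → subst (λ N → 4 ∣ ā (2 * α) N) (argument n k)
    (4∣ā (M-odd n k) (odd-power-not-square pp p∤2n+1 k) (2 * α))) ,
  (λ _ n k p∤2n+1 → subst (λ N → 8 ∣ ā (2 * β + 1) N) (argument n k)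
    (8∣ā (M-odd n k) (odd-power-not-square pp p∤2n+1 k) β))
  where
  regroup : ∀ q n → 2 * (q * (2 * n + 1)) ≡ 4 * q * n + 2 * q
  regroup = solve-∀
  argument : ∀ n k → 2 * (p ^ (2 * k + 1) * (2 * n + 1)) ≡ 4 * p ^ (2 * k + 1) * n + 2 * p ^ (2 * k + 1)
  argument n k = regroup (p ^ (2 * k + 1)) n
  -- Both factors are odd: the prime `p` is at least 3, hence odd, and so are its powers.
  M-odd : ∀ n k → 2 ∤ p ^ (2 * k + 1) * (2 * n + 1)
  M-odd n k 2∣M with euclidsLemma (p ^ (2 * k + 1)) (2 * n + 1) prime[2] 2∣M
  ... | inj₁ 2∣pᵉ   = prime-∤-^ prime[2] (odd-prime-∤2 pp 3≤p) (2 * k + 1) 2∣pᵉ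
  ... | inj₂ 2∣2n+1 = contradiction (∣1⇒≡1 (∣m+n∣m⇒∣n 2∣2n+1 (m∣m*n n))) λ ()
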